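{- The sets of patterns $\{123,1322\}$ and $\{132,1223\}$ are $m$-equivalent, that is, $\{123,1322\}\sim\{132,1223\}$.
   Context: A (finite, reduced) multiset is $S=1^{a_1}2^{a_2}\cdots k^{a_k}$ with $k\ge 1$ and all $a_i\ge 1$, meaning that $i$ occurs with multiplicity $a_i$. A multipermutation of $S$ is a word having exactly $a_i$ occurrences of each letter $i\in[k]=\{1,\dots,k\}$ and no other letters. A word $\pi=\pi_1\cdots\pi_n$ contains a pattern (word) $\rho=\rho_1\cdots\rho_\ell$ if there are indices $i(1)<\cdots<i(\ell)$ such that for all $a,b\in[\ell]$: $\pi_{i(a)}<\pi_{i(b)}$ iff $\rho_a<\rho_b$, and $\pi_{i(a)}>\pi_{i(b)}$ iff $\rho_a>\rho_b$; otherwise $\pi$ avoids $\rho$. For a set $P$ of patterns, $\mathrm{av}(S;P)$ is the number of multipermutations of $S$ that avoid every pattern in $P$. Two sets of patterns $P,Q$ are $m$-equivalent, written here $P\sim Q$, if $\mathrm{av}(S;P)=\mathrm{av}(S;Q)$ for every multiset $S$. -}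

module Defs where

open import Data.Fin.Base using (Fin; zero; suc; toℕ; fromℕ<)
import Data.Fin.Base as Fin
open import Data.Fin.Properties using (any?; all?; toℕ-injective; toℕ-fromℕ<)
import Data.Fin.Properties as Fin
open import Data.List.Base as List
  using (List; []; _∷_; length; filter; applyUpTo; cartesianProductWith)
open import Data.List.Membership.Propositional using (_∈_)
open import Data.List.Membership.Propositional.Properties
  using (∈-filter⁺; ∈-filter⁻; ∈-applyUpTo⁺; ∈-cartesianProductWith⁺)
open import Data.List.Properties using (filter-accept; filter-reject; ∷-injective)
open import Data.List.Relation.Unary.All as All using (All; []; _∷_)
open import Data.List.Relation.Unary.AllPairs using ([]; _∷_)
open import Data.List.Relation.Unary.Any using (here)
open import Data.List.Relation.Unary.Unique.Propositional using (Unique)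
import Data.List.Relation.Unary.Unique.Propositional.Properties as Unique
open import Data.Nat.Base using (ℕ; zero; suc; _+_; _≤_; _<_; _>_)
open import Data.Nat.Properties using (_≟_; _≤?_; _<?_; <⇒≢; suc-injective; +-suc)
open import Data.Product.Base using (∃; ∃-syntax; _×_; _,_; proj₁; proj₂)
open import Data.Vec.Base as Vec using (Vec; []; _∷_)
open import Data.Vec.Properties using (lookup∘tabulate)
open import Function.Base using (_∘_)
open import Function.Bundles using (_⇔_; mk⇔; Equivalence)
open import Relation.Binary.PropositionalEquality
  using (_≡_; _≢_; refl; sym; trans; cong; cong₂; subst)
open import Relation.Nullary.Decidable
  using (Dec; map′; _×-dec_; _→-dec_; ¬?)
open import Relation.Nullary.Negation using (¬_)
open import Relation.Unary using (Decidable)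

Word : Set
Word = List ℕ

Pattern : Set
Pattern = Word

-- mult = (a₁ , … , a_k): the entry at i : Fin k is the multiplicity of the
-- letter  suc (toℕ i) , since letters are numbered from 1.
record Multiset : Set where
  field
    k        : ℕ
    1≤k      : 1 ≤ k
    mult     : Vec ℕ k
    positive : ∀ i → 1 ≤ Vec.lookup mult i

  size : ℕ
  size = Vec.sum mult

letter : ∀ {k} → Fin k → ℕ
letter i = suc (toℕ i)

occurrences : ℕ → Word → ℕ
occurrences x π = length (filter (x ≟_) π)

IsMultipermutation : Multiset → Word → Set
IsMultipermutation S π =
    All (λ x → 1 ≤ x × x ≤ k) π
  × (∀ i → occurrences (letter i) π ≡ Vec.lookup mult i)
  where open Multiset S

-- The positions i(1), …, i(ℓ) at which ρ occurs in π, as a vector.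
IsOccurrence : (π : Word) (ρ : Pattern) → Vec (Fin (length π)) (length ρ) → Set
IsOccurrence π ρ i =
    (∀ a b → a Fin.< b → Vec.lookup i a Fin.< Vec.lookup i b)
  × (∀ a b → (π-at a < π-at b) ⇔ (ρ-at a < ρ-at b))
  × (∀ a b → (π-at a > π-at b) ⇔ (ρ-at a > ρ-at b))
  where
  π-at ρ-at : Fin (length ρ) → ℕ
  π-at a = List.lookup π (Vec.lookup i a)
  ρ-at a = List.lookup ρ a

_Contains_ : Word → Pattern → Set
π Contains ρ = ∃[ i ] IsOccurrence π ρ i

_Avoids_ : Word → Pattern → Set
π Avoids ρ = ¬ (π Contains ρ)

-- A finite set of patterns is given by a list; order and repetitions are
-- irrelevant to avoidance.
_AvoidsAll_ : Word → List Pattern → Set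
π AvoidsAll P = All (π Avoids_) P

private
  infix 2 _⇔?_
  _⇔?_ : {A B : Set} → Dec A → Dec B → Dec (A ⇔ B)
  A? ⇔? B? = map′ (λ (f , g) → mk⇔ f g) (λ e → Equivalence.to e , Equivalence.from e)
                  ((A? →-dec B?) ×-dec (B? →-dec A?))

  anyVec? : ∀ {n} ℓ {P : Vec (Fin n) ℓ → Set} → Decidable P → Dec (∃ P)
  anyVec? zero    P? = map′ (λ p → [] , p) (λ { ([] , p) → p }) (P? [])
  anyVec? (suc ℓ) P? =
    map′ (λ (x , v , p) → x ∷ v , p) (λ { (x ∷ v , p) → x , v , p })
         (any? λ x → anyVec? ℓ λ v → P? (x ∷ v))

isMultipermutation? : ∀ S → Decidable (IsMultipermutation S)
isMultipermutation? S π =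
  All.all? (λ x → (1 ≤? x) ×-dec (x ≤? k)) π
  ×-dec all? (λ i → occurrences (letter i) π ≟ Vec.lookup mult i)
  where open Multiset S

isOccurrence? : ∀ π ρ → Decidable (IsOccurrence π ρ)
isOccurrence? π ρ i =
        (all? λ a → all? λ b → (a Fin.<? b) →-dec (Vec.lookup i a Fin.<? Vec.lookup i b))
  ×-dec (all? λ a → all? λ b → (π-at a <? π-at b) ⇔? (ρ-at a <? ρ-at b))
  ×-dec (all? λ a → all? λ b → (π-at b <? π-at a) ⇔? (ρ-at b <? ρ-at a))
  where
  π-at ρ-at : Fin (length ρ) → ℕ
  π-at a = List.lookup π (Vec.lookup i a)
  ρ-at a = List.lookup ρ a

contains? : ∀ π ρ → Dec (π Contains ρ)
contains? π ρ = anyVec? (length ρ) (isOccurrence? π ρ)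

avoidsAll? : ∀ P → Decidable (_AvoidsAll P)
avoidsAll? P π = All.all? (λ ρ → ¬? (contains? π ρ)) P

-- All words of length n over {1, …, k}.
words : (k n : ℕ) → List Word
words k zero    = [] ∷ []
words k (suc n) = cartesianProductWith _∷_ (applyUpTo suc k) (words k n)

GoodWord : Multiset → List Pattern → Word → Set
GoodWord S P π = IsMultipermutation S π × π AvoidsAll P

goodWord? : ∀ S P → Decidable (GoodWord S P)
goodWord? S P π = isMultipermutation? S π ×-dec avoidsAll? P π

avoiders : Multiset → List Pattern → List Word
avoiders S P = filter (goodWord? S P) (words k size)
  where open Multiset S

-- That this is the number of words π with  GoodWord S P π  is the content of
-- avoiders-unique and ∈-avoiders below.
av : Multiset → List Pattern → ℕ
av S P = length (avoiders S P)

infix 4 _∼_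
_∼_ : List Pattern → List Pattern → Set
P ∼ Q = ∀ S → av S P ≡ av S Q

words-unique : ∀ k n → Unique (words k n)
words-unique k zero    = [] ∷ []
words-unique k (suc n) =
  Unique.cartesianProductWith⁺ _∷_ ∷-injective
    (Unique.applyUpTo⁺₁ suc k λ i<j _ → <⇒≢ i<j ∘ suc-injective)
    (words-unique k n)

avoiders-unique : ∀ S P → Unique (avoiders S P)
avoiders-unique S P =
  Unique.filter⁺ (goodWord? S P) (words-unique (Multiset.k S) (Multiset.size S))

∈-words : ∀ {k} {π} → All (λ x → 1 ≤ x × x ≤ k) π → π ∈ words k (length π)
∈-words [] = here refl
∈-words {π = suc x ∷ _} ((_ , x<k) ∷ ps) =
  ∈-cartesianProductWith⁺ _∷_ (∈-applyUpTo⁺ suc x<k) (∈-words ps)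

private
  sum-zero : ∀ {k} (v : Vec ℕ k) → (∀ i → 0 ≡ Vec.lookup v i) → 0 ≡ Vec.sum v
  sum-zero []      _ = refl
  sum-zero (x ∷ v) h = cong₂ _+_ (h zero) (sum-zero v (h ∘ suc))

  sum-cong : ∀ {k} (u v : Vec ℕ k) → (∀ i → Vec.lookup u i ≡ Vec.lookup v i) →
             Vec.sum u ≡ Vec.sum v
  sum-cong []      []      _ = refl
  sum-cong (x ∷ u) (y ∷ v) h = cong₂ _+_ (h zero) (sum-cong u v (h ∘ suc))

  sum-bump : ∀ {k} (u v : Vec ℕ k) j → suc (Vec.lookup u j) ≡ Vec.lookup v j →
             (∀ i → i ≢ j → Vec.lookup u i ≡ Vec.lookup v i) →
             suc (Vec.sum u) ≡ Vec.sum v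
  sum-bump (x ∷ u) (y ∷ v) zero    e h =
    cong₂ _+_ e (sum-cong u v λ i → h (suc i) λ ())
  sum-bump (x ∷ u) (y ∷ v) (suc j) e h =
    trans (sym (+-suc x (Vec.sum u)))
      (cong₂ _+_ (h zero λ ())
        (sum-bump u v j e λ i i≢j → h (suc i) (i≢j ∘ Fin.suc-injective)))

  length≡sum : ∀ {k} π (v : Vec ℕ k) → All (λ x → 1 ≤ x × x ≤ k) π →
               (∀ i → occurrences (letter i) π ≡ Vec.lookup v i) →
               length π ≡ Vec.sum v
  length≡sum []          v _ h = sum-zero v h
  length≡sum {k} (suc x ∷ π) v ((_ , x<k) ∷ ps) h =
    trans (cong suc (length≡sum π u ps λ i → sym (lookup∘tabulate occ i)))
          (sum-bump u v j at-j off-j)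
    where
    occ : Fin k → ℕ
    occ i = occurrences (letter i) π
    u = Vec.tabulate occ
    j = fromℕ< x<k
    at-j : suc (Vec.lookup u j) ≡ Vec.lookup v j
    at-j = trans (cong suc (lookup∘tabulate occ j))
      (trans (sym (cong length (filter-accept (letter j ≟_) (cong suc (toℕ-fromℕ< x<k)))))
             (h j))
    off-j : ∀ i → i ≢ j → Vec.lookup u i ≡ Vec.lookup v i
    off-j i i≢j = trans (lookup∘tabulate occ i)
      (trans (sym (cong length (filter-reject (letter i ≟_)
               λ e → i≢j (toℕ-injective (trans (suc-injective e) (sym (toℕ-fromℕ< x<k)))))))
             (h i))

multipermutation-length : ∀ S {π} → IsMultipermutation S π → length π ≡ Multiset.size S
multipermutation-length S {π} (ps , h) = length≡sum π (Multiset.mult S) ps h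

∈-avoiders : ∀ S P π → π ∈ avoiders S P ⇔ GoodWord S P π
∈-avoiders S P π = mk⇔ (λ m → proj₂ (∈-filter⁻ (goodWord? S P) {xs = ws} m)) from
  where
  ws = words (Multiset.k S) (Multiset.size S)
  from : GoodWord S P π → π ∈ avoiders S P
  from g@((ps , h) , _) = ∈-filter⁺ (goodWord? S P)
    (subst (λ n → π ∈ words (Multiset.k S) n)
           (multipermutation-length S (ps , h)) (∈-words ps)) g

{-# OPTIONS --safe #-}
module Submission where

-- A Simion–Schmidt argument with weak left-to-right minima.  Fix the positions and
-- values of the minima and the multiset R of the other letters.  At most one filling
-- of the remaining positions avoids 123 (always put the largest remaining letter) and
-- at most one avoids 132 (put the smallest remaining letter above the current
-- minimum); each exists as soon as any admissible filling does.  In either case the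
-- pattern of length four is avoided exactly when, for every b repeated in R, the
-- letters of R above b all sit where the current minimum is at least b, and this is a
-- condition on the minima and on R alone, so the two fillings satisfy it together.

open import Defs
open import Data.List.Base using (List; []; _∷_)

open import Data.Fin.Base as Fin using (Fin; zero; suc; punchOut)
open import Data.Fin.Properties as Fin using (punchIn-punchOut)
open import Data.List.Base as List using (_++_; catMaybes; filter; length; map; tabulate)
open import Data.List.Extrema.Nat using (argmax-sel; argmin-sel; max; min; xs≤max; ⊥≤max; min≤⊤; min≤xs; v<min⁺)
open import Data.List.Membership.Propositional using (_∈_)
open import Data.List.Membership.Propositional.Properties using (∈-filter⁺; ∈-filter⁻; ∈-lookup; ∈-∃++)
open import Data.List.Properties using (filter-accept; filter-reject; tabulate-cong)
open import Data.List.Relation.Binary.Permutation.Propositional using (_↭_; prep; swap; ↭-refl; ↭-sym; ↭-trans)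
open import Data.List.Relation.Binary.Permutation.Propositional.Properties
  using (All-resp-↭; ∈-resp-↭; drop-∷; filter-↭; shift; ++⁺ˡ; ↭-length)
open import Data.List.Relation.Binary.Sublist.Propositional
  using (_⊆_; []; _∷_; _∷ʳ_; minimum; ⊆-refl; ⊆-trans; from∈; to∈)
open import Data.List.Relation.Binary.Sublist.Propositional.Properties using (Any-resp-⊆)
open import Data.List.Relation.Unary.All as All using (All; []; _∷_)
open import Data.List.Relation.Unary.All.Properties using (all-filter)
open import Data.List.Relation.Unary.Any using (here; there)
open import Data.List.Relation.Unary.AllPairs using ([]; _∷_)
open import Data.List.Relation.Unary.Unique.Propositional using (Unique)
open import Data.Maybe.Base using (Maybe; just; nothing)
open import Data.Nat.Base using (ℕ; zero; suc; _+_; _≤_; _<_; z≤n; s≤s)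
open import Data.Nat.Properties
open import Data.Product.Base using (∃-syntax; ∃₂; _×_; _,_; proj₁; proj₂)
open import Data.Sum.Base using (_⊎_; inj₁; inj₂)
open import Data.Vec.Base as Vec using (Vec)
open import Data.Vec.Properties using (lookup∘tabulate)
open import Function.Base using (_∘_; id)
open import Function.Bundles using (_⇔_; mk⇔; Equivalence)
open import Relation.Binary.Definitions using (tri<; tri≈; tri>)
open import Relation.Binary.PropositionalEquality using (_≡_; _≢_; refl; sym; trans; cong; subst; subst₂)
open import Relation.Nullary.Decidable using (yes; no)
open import Relation.Nullary.Negation using (¬_; contradiction)

private
  variable
    A       : Set
    a b c m x y β : ℕ
    w w′ π π′ ρ τ τ′ υ R R′ : List ℕ

-- Pattern containment in terms of sublists.

StrictlyIncreasing : ∀ {m n} → (Fin m → Fin n) → Set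
StrictlyIncreasing h = ∀ i j → i Fin.< j → h i Fin.< h j

0≢h-suc : ∀ {m n} {h : Fin (suc m) → Fin (suc n)} → StrictlyIncreasing h → ∀ i → zero ≢ h (suc i)
0≢h-suc mono i e = <⇒≢ (≤-<-trans z≤n (mono zero (suc i) (s≤s z≤n))) (cong Fin.toℕ e)

mutual
  tabulate-lookup-⊆ : ∀ {A : Set} {n} (xs : List A) (h : Fin n → Fin (length xs)) →
    StrictlyIncreasing h → tabulate (List.lookup xs ∘ h) ⊆ xs
  tabulate-lookup-⊆ {n = zero}  xs       h mono = minimum xs
  tabulate-lookup-⊆ {n = suc n} []       h mono with () ← h zero
  tabulate-lookup-⊆ {n = suc n} (x ∷ xs) h mono with zero Fin.≟ h zero
  ... | yes 0≡h0 = cong (List.lookup (x ∷ xs)) (sym 0≡h0)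
                 ∷ tabulate-lookup-⊆-tail x xs (h ∘ suc) (0≢h-suc mono)
                     (λ i j i<j → mono (suc i) (suc j) (s≤s i<j))
  ... | no 0≢h0 = x ∷ʳ tabulate-lookup-⊆-tail x xs h
    (λ { zero → 0≢h0 ; (suc i) → 0≢h-suc mono i }) mono

  tabulate-lookup-⊆-tail : ∀ {A : Set} {n} x (xs : List A) (h : Fin n → Fin (suc (length xs))) →
    (∀ i → zero ≢ h i) → StrictlyIncreasing h → tabulate (List.lookup (x ∷ xs) ∘ h) ⊆ xs
  tabulate-lookup-⊆-tail x xs h 0≢h mono =
    subst (_⊆ xs) (tabulate-cong (cong (List.lookup (x ∷ xs)) ∘ suc-h-pred))
      (tabulate-lookup-⊆ xs h-pred λ i j i<j →
        ≤-pred (subst₂ Fin._<_ (sym (suc-h-pred i)) (sym (suc-h-pred j)) (mono i j i<j)))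
    where
    h-pred : ∀ i → Fin (length xs)
    h-pred i = punchOut (0≢h i)
    suc-h-pred : ∀ i → suc (h-pred i) ≡ h i
    suc-h-pred i = punchIn-punchOut (0≢h i)

-- The last component is there to recover equalities: where neither of two pattern letters is below
-- the other, neither value is, so the two copies of a repeated letter coincide.
contains⇒⊆ : π Contains ρ → ∃[ g ] tabulate {n = length ρ} g ⊆ π
  × (∀ i j → List.lookup ρ i < List.lookup ρ j → g i < g j)
  × (∀ i j → ¬ List.lookup ρ i < List.lookup ρ j → ¬ g i < g j)
contains⇒⊆ {π} (v , mono , iso , _) =
    List.lookup π ∘ Vec.lookup v , tabulate-lookup-⊆ π (Vec.lookup v) mono
  , (λ i j → Equivalence.from (iso i j)) , λ i j ≮ → ≮ ∘ Equivalence.to (iso i j)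

position : (f : ℕ → ℕ) (ρ : Word) → map f ρ ⊆ π → Fin (length ρ) → Fin (length π)
position f ρ@(_ ∷ _) (_ ∷ʳ s) i     = suc (position f ρ s i)
position f (_ ∷ _) (_ ∷ s)  zero    = zero
position f (_ ∷ ρ) (_ ∷ s)  (suc i) = suc (position f ρ s i)

position-increasing : ∀ f ρ (s : map f ρ ⊆ π) → StrictlyIncreasing (position f ρ s)
position-increasing f ρ@(_ ∷ _) (_ ∷ʳ s) i       j       i<j       = s≤s (position-increasing f ρ s i j i<j)
position-increasing f (_ ∷ _) (_ ∷ s)  zero    (suc j) _         = s≤s z≤n
position-increasing f (_ ∷ ρ) (_ ∷ s)  (suc i) (suc j) (s≤s i<j) = s≤s (position-increasing f ρ s i j i<j)

lookup-position : ∀ f ρ (s : map f ρ ⊆ π) i → List.lookup π (position f ρ s i) ≡ f (List.lookup ρ i)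
lookup-position f ρ@(_ ∷ _) (_ ∷ʳ s) i       = lookup-position f ρ s i
lookup-position f (_ ∷ _) (e ∷ s)  zero    = sym e
lookup-position f (_ ∷ ρ) (_ ∷ s)  (suc i) = lookup-position f ρ s i

-- By trichotomy a strictly monotone `f` also reflects the order. Monotonicity is asked from 1 on
-- only, since `relabel` may fail it at 0.
map-⊆⇒contains : ∀ f → (∀ {x y} → 1 ≤ x → x < y → f x < f y) → All (1 ≤_) ρ → map f ρ ⊆ π → π Contains ρ
map-⊆⇒contains {ρ} {π} f mono 1≤ρ s =
    v
  , (λ i j i<j → subst₂ Fin._<_ (sym (lookup∘tabulate p i)) (sym (lookup∘tabulate p j))
      (position-increasing f ρ s i j i<j))
  , iso , λ i j → iso j i
  where
  p = position f ρ s
  v = Vec.tabulate p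
  at : ∀ i → f (List.lookup ρ i) ≡ List.lookup π (Vec.lookup v i)
  at i = trans (sym (lookup-position f ρ s i)) (cong (List.lookup π) (sym (lookup∘tabulate p i)))
  1≤ : ∀ i → 1 ≤ List.lookup ρ i
  1≤ i = All.lookup 1≤ρ (∈-lookup i)
  reflects : ∀ i j → f (List.lookup ρ i) < f (List.lookup ρ j) → List.lookup ρ i < List.lookup ρ j
  reflects i j fi<fj with <-cmp (List.lookup ρ i) (List.lookup ρ j)
  ... | tri< i<j _ _ = i<j
  ... | tri≈ _ i≡j _ = contradiction (cong f i≡j) (<⇒≢ fi<fj)
  ... | tri> _ _ j<i = contradiction (mono (1≤ j) j<i) (<-asym fi<fj)
  iso : ∀ i j → (List.lookup π (Vec.lookup v i) < List.lookup π (Vec.lookup v j))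
              ⇔ (List.lookup ρ i < List.lookup ρ j)
  iso i j = mk⇔ (reflects i j ∘ subst₂ _<_ (sym (at i)) (sym (at j)))
                (subst₂ _<_ (at i) (at j) ∘ mono (1≤ i))

-- Pattern letters are positive, so the value at 0 is junk.
relabel : ℕ → ℕ → ℕ → ℕ → ℕ
relabel a b c 0                   = 0
relabel a b c 1                   = a
relabel a b c 2                   = b
relabel a b c (suc (suc (suc n))) = c + n

relabel-mono : a < b → b < c → 1 ≤ x → x < y → relabel a b c x < relabel a b c y
relabel-mono {x = 1} {2}                   a<b b<c _ _ = a<b
relabel-mono {x = 1} {suc (suc (suc y))}   a<b b<c _ _ = m≤n⇒m≤n+o y (<-trans a<b b<c)
relabel-mono {x = 1} {1}                   a<b b<c _ (s≤s ())
relabel-mono {x = 2} {1}                   a<b b<c _ (s≤s ())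
relabel-mono {x = 2} {2}                   a<b b<c _ (s≤s (s≤s ()))
relabel-mono {x = 2} {suc (suc (suc y))}   a<b b<c _ _ = m≤n⇒m≤n+o y b<c
relabel-mono {c = c} {suc (suc (suc x))} {suc (suc (suc y))} a<b b<c _ (s≤s (s≤s (s≤s x<y))) = +-monoʳ-< c x<y
relabel-mono {x = suc (suc (suc x))} {1}   a<b b<c _ (s≤s ())
relabel-mono {x = suc (suc (suc x))} {2}   a<b b<c _ (s≤s (s≤s ()))

-- A bound β instead of the value a itself lets a be replaced by any smaller letter.
Below : ℕ → List ℕ → Word → Set
Below β τ w = ∃[ a ] a < β × (a ∷ τ) ⊆ w

No123 No132 No1322 No1223 : Word → Set
No123  w = ∀ {b c} → b < c → ¬ Below b (b ∷ c ∷ []) w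
No132  w = ∀ {b c} → b < c → ¬ Below b (c ∷ b ∷ []) w
No1322 w = ∀ {b c} → b < c → ¬ Below b (c ∷ b ∷ b ∷ []) w
No1223 w = ∀ {b c} → b < c → ¬ Below b (b ∷ b ∷ c ∷ []) w

pattern #0 = zero
pattern #1 = suc #0
pattern #2 = suc #1
pattern #3 = suc #2

-- The four patterns expressed through `Below`.

avoids-123 : w Avoids (1 ∷ 2 ∷ 3 ∷ []) ⇔ No123 w
avoids-123 {w} = mk⇔ to from
  where
  to : w Avoids (1 ∷ 2 ∷ 3 ∷ []) → No123 w
  -- `relabel` sends 3 to `c + 0`, which is not `c` by computation; hence the `subst`.
  to avoids b<c (a , a<b , s) = avoids (map-⊆⇒contains (relabel a _ _) (relabel-mono a<b b<c)
    (s≤s z≤n ∷ s≤s z≤n ∷ s≤s z≤n ∷ []) (subst (λ z → a ∷ _ ∷ z ∷ [] ⊆ w) (sym (+-identityʳ _)) s))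
  from : No123 w → w Avoids (1 ∷ 2 ∷ 3 ∷ [])
  from avoids con with g , s , mono , _ ← contains⇒⊆ con =
    avoids (mono #1 #2 ≤-refl) (g #0 , mono #0 #1 ≤-refl , s)

avoids-132 : w Avoids (1 ∷ 3 ∷ 2 ∷ []) ⇔ No132 w
avoids-132 {w} = mk⇔ to from
  where
  to : w Avoids (1 ∷ 3 ∷ 2 ∷ []) → No132 w
  to avoids b<c (a , a<b , s) = avoids (map-⊆⇒contains (relabel a _ _) (relabel-mono a<b b<c)
    (s≤s z≤n ∷ s≤s z≤n ∷ s≤s z≤n ∷ []) (subst (λ z → a ∷ z ∷ _ ∷ [] ⊆ w) (sym (+-identityʳ _)) s))
  from : No132 w → w Avoids (1 ∷ 3 ∷ 2 ∷ [])
  from avoids con with g , s , mono , _ ← contains⇒⊆ con =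
    avoids (mono #2 #1 ≤-refl) (g #0 , mono #0 #2 ≤-refl , s)

avoids-1322 : w Avoids (1 ∷ 3 ∷ 2 ∷ 2 ∷ []) ⇔ No1322 w
avoids-1322 {w} = mk⇔ to from
  where
  to : w Avoids (1 ∷ 3 ∷ 2 ∷ 2 ∷ []) → No1322 w
  to avoids b<c (a , a<b , s) = avoids (map-⊆⇒contains (relabel a _ _) (relabel-mono a<b b<c)
    (s≤s z≤n ∷ s≤s z≤n ∷ s≤s z≤n ∷ s≤s z≤n ∷ [])
    (subst (λ z → a ∷ z ∷ _ ∷ _ ∷ [] ⊆ w) (sym (+-identityʳ _)) s))
  from : No1322 w → w Avoids (1 ∷ 3 ∷ 2 ∷ 2 ∷ [])
  from avoids con with g , s , mono , anti ← contains⇒⊆ con =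
    avoids (mono #2 #1 ≤-refl) (g #0 , mono #0 #2 ≤-refl , subst (λ z → g #0 ∷ g #1 ∷ g #2 ∷ z ∷ [] ⊆ w)
      (≤-antisym (≮⇒≥ (anti #2 #3 (<-irrefl refl))) (≮⇒≥ (anti #3 #2 (<-irrefl refl)))) s)

avoids-1223 : w Avoids (1 ∷ 2 ∷ 2 ∷ 3 ∷ []) ⇔ No1223 w
avoids-1223 {w} = mk⇔ to from
  where
  to : w Avoids (1 ∷ 2 ∷ 2 ∷ 3 ∷ []) → No1223 w
  to avoids b<c (a , a<b , s) = avoids (map-⊆⇒contains (relabel a _ _) (relabel-mono a<b b<c)
    (s≤s z≤n ∷ s≤s z≤n ∷ s≤s z≤n ∷ s≤s z≤n ∷ [])
    (subst (λ z → a ∷ _ ∷ _ ∷ z ∷ [] ⊆ w) (sym (+-identityʳ _)) s))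
  from : No1223 w → w Avoids (1 ∷ 2 ∷ 2 ∷ 3 ∷ [])
  from avoids con with g , s , mono , anti ← contains⇒⊆ con =
    avoids (mono #1 #3 ≤-refl) (g #0 , mono #0 #1 ≤-refl , subst (λ z → g #0 ∷ g #1 ∷ z ∷ g #3 ∷ [] ⊆ w)
      (≤-antisym (≮⇒≥ (anti #1 #2 (<-irrefl refl))) (≮⇒≥ (anti #2 #1 (<-irrefl refl)))) s)

-- Moving the low letter of an occurrence.

Below-⊆ : w ⊆ w′ → Below β τ w → Below β τ w′
Below-⊆ s (a , a<β , t) = a , a<β , ⊆-trans t s

⊇-Below : τ ⊆ τ′ → Below β τ′ w → Below β τ w
⊇-Below s (a , a<β , t) = a , a<β , ⊆-trans (refl ∷ s) t

skip-second : x ∷ π ⊆ x ∷ y ∷ π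
skip-second = refl ∷ _ ∷ʳ ⊆-refl

-- If `x` is the low letter, the smaller and earlier `m` can replace it. Otherwise `x` is skipped,
-- or it follows the low letter `m` as the head of `τ`.
Below-lower : m < x → Below β τ (m ∷ x ∷ π) →
  Below β τ (m ∷ π) ⊎ (m < β × ∃[ τ′ ] τ ≡ x ∷ τ′ × τ′ ⊆ π)
Below-lower m<x (a , a<β , refl ∷ (_ ∷ʳ s))    = inj₁ (a , a<β , refl ∷ s)
Below-lower m<x (a , a<β , refl ∷ (refl ∷ s))  = inj₂ (a<β , _ , refl , s)
Below-lower m<x (a , a<β , _ ∷ʳ (_ ∷ʳ s))      = inj₁ (a , a<β , _ ∷ʳ s)
Below-lower m<x (a , a<β , _ ∷ʳ (refl ∷ s))    = inj₁ (_ , <-trans m<x a<β , refl ∷ s)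

-- Here `x` can take over from `m` as the low letter. It cannot be `c` with `m` low, since that
-- would give `x ≤ m < β ≤ c`.
Below-replace : x ≤ m → β ≤ c → Below β (c ∷ τ) (m ∷ x ∷ π) → Below β (c ∷ τ) (x ∷ π)
Below-replace x≤m β≤c (a , a<β , _ ∷ʳ s)          = a , a<β , s
Below-replace x≤m β≤c (a , a<β , refl ∷ (_ ∷ʳ s)) = _ , ≤-<-trans x≤m a<β , refl ∷ s
Below-replace x≤m β≤c (a , a<β , refl ∷ (refl ∷ s)) = contradiction (≤-trans β≤c x≤m) (<⇒≱ a<β)

-- Decomposition of a word into weak left-to-right minima and the rest.

-- The word m ∷ π has weak left-to-right minima m and the entries x of σ given as
-- just x; the letters in its other positions, marked nothing in σ, form R.
data Parse (m : ℕ) : List (Maybe ℕ) → List ℕ → Word → Set where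
  []   : Parse m [] [] []
  low  : ∀ {x σ R π} → x ≤ m → Parse x σ R π → Parse m (just x ∷ σ) R (x ∷ π)
  high : ∀ {x σ R π} → m < x → Parse m σ R π → Parse m (nothing ∷ σ) (x ∷ R) (x ∷ π)

private
  variable
    σ σ′ : List (Maybe ℕ)

parse : ∀ m π → ∃₂ λ σ R → Parse m σ R π
parse m []      = _ , _ , []
parse m (x ∷ π) with x ≤? m
... | yes x≤m with _ , _ , p ← parse x π = _ , _ , low x≤m p
... | no  x≰m with _ , _ , p ← parse m π = _ , _ , high (≰⇒> x≰m) p

parse-unique : Parse m σ R π → Parse m σ′ R′ π → σ ≡ σ′ × R ≡ R′
parse-unique []            []            = refl , refl
parse-unique (low _ p)     (low _ q)     with refl , refl ← parse-unique p q = refl , refl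
parse-unique (high _ p)    (high _ q)    with refl , refl ← parse-unique p q = refl , refl
parse-unique (low x≤m _)   (high m<x _)  = contradiction x≤m (<⇒≱ m<x)
parse-unique (high m<x _)  (low x≤m _)   = contradiction x≤m (<⇒≱ m<x)

parse-⊆ : Parse m σ R π → R ⊆ π
parse-⊆ []         = []
parse-⊆ (low _ p)  = _ ∷ʳ parse-⊆ p
parse-⊆ (high _ p) = refl ∷ parse-⊆ p

parse-↭ : Parse m σ R π → π ↭ catMaybes σ ++ R
parse-↭ []                                = ↭-refl
parse-↭ (low {x = x} _ p)                 = prep x (parse-↭ p)
parse-↭ (high {x = x} {σ} {R} _ p)        =
  ↭-trans (prep x (parse-↭ p)) (↭-sym (shift x (catMaybes σ) R))

-- After a letter below `β` every further minimum is below `β` too, so later letters that are at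
-- least `β` are not minima.
Below⇒⊆-high : Parse m σ R π → All (β ≤_) τ → Below β τ (m ∷ π) → τ ⊆ R
Below⇒⊆-high {τ = []}    p          _         _ = minimum _
Below⇒⊆-high {τ = _ ∷ _} []         _         (_ , _ , _ ∷ʳ ())
Below⇒⊆-high {τ = _ ∷ _} []         _         (_ , _ , _ ∷ ())
Below⇒⊆-high {τ = _ ∷ _} (low x≤m p) (β≤c ∷ β≤τ) o = Below⇒⊆-high p (β≤c ∷ β≤τ) (Below-replace x≤m β≤c o)
Below⇒⊆-high {τ = _ ∷ _} (high m<x p) (β≤c ∷ β≤τ) o with Below-lower m<x o
... | inj₁ o′                       = _ ∷ʳ Below⇒⊆-high p (β≤c ∷ β≤τ) o′
... | inj₂ (m<β , _ , refl , s)     = refl ∷ Below⇒⊆-high p β≤τ (_ , m<β , refl ∷ s)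

-- Greedy fillings of the non-minimum positions.

-- `Better m y z` is the preference for `y` over `z` where the current minimum is `m`; the two
-- pattern sets differ only in this preference.
module Fill
  (Better : ℕ → ℕ → ℕ → Set)
  (best : ∀ {m x} R → m < x → ∃[ y ] m < y × y ∈ x ∷ R × All (Better m y) (x ∷ R))
  (best-unique : ∀ {m x y} → m < x → m < y → Better m x y → Better m y x → x ≡ y)
  where

  data Greedy {m} : Parse m σ R π → Set where
    []   : Greedy []
    low  : ∀ {x σ R π} {x≤m : x ≤ m} {p : Parse x σ R π} → Greedy p → Greedy (low x≤m p)
    high : ∀ {x σ R π} {m<x : m < x} {p : Parse m σ R π} →
           All (Better m x) R → Greedy p → Greedy (high m<x p)

  -- If the heads differ, each occurs in the tail of the other list, so each is preferred to the
  -- other.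
  same-head : ∀ {R′ x′} → m < x → m < x′ → All (Better m x) R → All (Better m x′) R′ →
    x ∷ R ↭ x′ ∷ R′ → x ≡ x′
  same-head m<x m<x′ b b′ eq with ∈-resp-↭ eq (here refl) | ∈-resp-↭ (↭-sym eq) (here refl)
  ... | here x≡x′  | _          = x≡x′
  ... | there _    | here x′≡x  = sym x′≡x
  ... | there x∈R′ | there x′∈R = best-unique m<x m<x′ (All.lookup b x′∈R) (All.lookup b′ x∈R′)

  greedy-unique : {p : Parse m σ R π} {p′ : Parse m σ R′ π′} →
    Greedy p → Greedy p′ → R ↭ R′ → π ≡ π′
  greedy-unique []      []       _    = refl
  greedy-unique (low g) (low g′) R↭R′ = cong (_ ∷_) (greedy-unique g g′ R↭R′)
  greedy-unique (high {m<x = m<x} b g) (high {m<x = m<x′} b′ g′) R↭R′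
    with refl ← same-head m<x m<x′ b b′ R↭R′ = cong (_ ∷_) (greedy-unique g g′ (drop-∷ R↭R′))

  -- The current minimum never increases, so `x`, being above `m`, is admissible at every later
  -- position and can take the place of `y`.
  exchange : m < x → y ∈ x ∷ R → Parse m σ R π →
    ∃₂ λ R′ π′ → Parse m σ R′ π′ × x ∷ R ↭ y ∷ R′
  exchange m<x (here refl) p = _ , _ , p , ↭-refl
  exchange m<x (there y∈)  (low x≤m p) with _ , _ , p′ , eq ← exchange (≤-<-trans x≤m m<x) (there y∈) p =
    _ , _ , low x≤m p′ , eq
  exchange {x = x} m<x (there (here refl)) (high {x = z} _ p) = _ , _ , high m<x p , swap x z ↭-refl
  exchange {x = x} m<x (there (there y∈))  (high {x = z} m<z p)
    with _ , _ , p′ , eq ← exchange m<x (there y∈) p =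
    _ , _ , high m<z p′ , ↭-trans (swap x z ↭-refl) (↭-trans (prep z eq) (swap z _ ↭-refl))

  -- At each free position the best letter is fetched by `exchange` before the rest is refilled. The
  -- recursion is on `σ`, which `exchange` preserves while it replaces the parse.
  refill : ∀ σ → Parse m σ R π → ∃₂ λ R′ π′ → ∃[ p ] Greedy {m} {σ} {R′} {π′} p × R ↭ R′
  refill []             []          = _ , _ , _ , [] , ↭-refl
  refill (just _ ∷ σ)   (low x≤m p) with _ , _ , _ , g , eq ← refill σ p = _ , _ , _ , low {x≤m = x≤m} g , eq
  refill (nothing ∷ σ)  (high {R = R} m<x p)
    with y , m<y , y∈ , b      ← best R m<x
    with _ , _ , p₁ , eq₁      ← exchange m<x y∈ p
    with _ , _ , p₂ , g , eq₂  ← refill σ p₁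
    = _ , _ , high m<y p₂ , high (All.tail (All-resp-↭ (↭-trans eq₁ (prep y eq₂)) b)) g
    , ↭-trans eq₁ (prep y eq₂)

-- The counting condition behind the patterns of length four.

thresholds : ℕ → List (Maybe ℕ) → List ℕ
thresholds m []            = []
thresholds m (just x ∷ σ)  = thresholds x σ
thresholds m (nothing ∷ σ) = m ∷ thresholds m σ

slots : ℕ → ℕ → List (Maybe ℕ) → ℕ
slots b m σ = length (filter (b ≤?_) (thresholds m σ))

above : ℕ → List ℕ → ℕ
above b R = length (filter (b <?_) R)

-- Every letter above b in R sits where the current minimum is at least b, as
-- soon as b is repeated in R; the counts make this depend on R only up to ↭.
Tight : ℕ → List (Maybe ℕ) → List ℕ → Set
Tight m σ R = ∀ b → b ∷ b ∷ [] ⊆ R → above b R ≤ slots b m σ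

pair-↭ : R ↭ R′ → x ∷ x ∷ [] ⊆ R → x ∷ x ∷ [] ⊆ R′
pair-↭ _↭_.refl           s                    = s
pair-↭ (prep _ eq)        (_ ∷ʳ s)             = _ ∷ʳ pair-↭ eq s
pair-↭ (prep _ eq)        (refl ∷ s)           = refl ∷ from∈ (∈-resp-↭ eq (to∈ s))
pair-↭ (swap _ _ eq)      (_ ∷ʳ (_ ∷ʳ s))      = _ ∷ʳ (_ ∷ʳ pair-↭ eq s)
pair-↭ (swap _ _ eq)      (_ ∷ʳ (refl ∷ s))    = refl ∷ (_ ∷ʳ from∈ (∈-resp-↭ eq (to∈ s)))
pair-↭ (swap _ _ eq)      (refl ∷ (_ ∷ʳ s))    = _ ∷ʳ (refl ∷ from∈ (∈-resp-↭ eq (to∈ s)))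
pair-↭ (swap _ _ eq)      (refl ∷ (refl ∷ s))  = refl ∷ (refl ∷ minimum _)
pair-↭ (_↭_.trans eq eq′) s                    = pair-↭ eq′ (pair-↭ eq s)

Tight-↭ : R ↭ R′ → Tight m σ R → Tight m σ R′
Tight-↭ {m = m} {σ} R↭R′ t b bb =
  subst (_≤ slots b m σ) (↭-length (filter-↭ (b <?_) R↭R′)) (t b (pair-↭ (↭-sym R↭R′) bb))

above-∷-< : ∀ R → b < x → above b (x ∷ R) ≡ suc (above b R)
above-∷-< {b} R b<x = cong length (filter-accept (b <?_) {xs = R} b<x)

above-∷ : ∀ b x R → above b R ≤ above b (x ∷ R)
above-∷ b x R with b <? x
... | yes b<x = ≤-trans (n≤1+n _) (≤-reflexive (sym (above-∷-< R b<x)))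
... | no  b≮x = ≤-reflexive (sym (cong length (filter-reject (b <?_) {xs = R} b≮x)))

slots-≤ : ∀ σ → b ≤ m → slots b m (nothing ∷ σ) ≡ suc (slots b m σ)
slots-≤ {b} {m} σ b≤m = cong length (filter-accept (b ≤?_) {xs = thresholds m σ} b≤m)

slots-≰ : ∀ σ → ¬ b ≤ m → slots b m (nothing ∷ σ) ≡ slots b m σ
slots-≰ {b} {m} σ b≰m = cong length (filter-reject (b ≤?_) {xs = thresholds m σ} b≰m)

-- A letter in a slot exceeds a minimum that is at least `b`, so it is itself above `b`.
slots≤above : ∀ b → Parse m σ R π → slots b m σ ≤ above b R
slots≤above b []        = z≤n
slots≤above b (low _ p) = slots≤above b p
slots≤above {m = m} b (high {x} {σ} {R} m<x p) with b ≤? m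
... | yes b≤m rewrite slots-≤ σ b≤m | above-∷-< R (≤-<-trans b≤m m<x) = s≤s (slots≤above b p)
... | no  b≰m rewrite slots-≰ σ b≰m = ≤-trans (slots≤above b p) (above-∷ b x R)

-- The inequality of `slots≤above` becomes strict because `c` is above `b` but, coming after a
-- letter below `b`, sits in no slot.
slots<above : b < c → Parse m σ R π → Below b (c ∷ []) (m ∷ π) → slots b m σ < above b R
slots<above b<c []           (_ , _ , _ ∷ ())
slots<above b<c []           (_ , _ , _ ∷ʳ ())
slots<above b<c (low x≤m p)  o = slots<above b<c p (Below-replace x≤m (<⇒≤ b<c) o)
slots<above {b} {m = m} b<c (high {x} {σ} {R} m<x p) o with Below-lower m<x o | b ≤? m
... | inj₂ (m<b , _ , refl , _) | _ rewrite slots-≰ σ (<⇒≱ m<b) | above-∷-< R b<c = s≤s (slots≤above b p)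
... | inj₁ o′ | yes b≤m rewrite slots-≤ σ b≤m | above-∷-< R (≤-<-trans b≤m m<x) = s≤s (slots<above b<c p o′)
... | inj₁ o′ | no  b≰m rewrite slots-≰ σ b≰m = ≤-trans (slots<above b<c p o′) (above-∷ b x R)

-- A letter above `b` in a non-minimum position outside the slots would follow a minimum below `b`,
-- which the hypothesis forbids.
above≤slots : Parse m σ R π → (∀ {c} → b < c → ¬ Below b (c ∷ []) (m ∷ π)) → above b R ≤ slots b m σ
above≤slots []        avoids = z≤n
above≤slots (low _ p) avoids = above≤slots p λ b<c → avoids b<c ∘ Below-⊆ (_ ∷ʳ ⊆-refl)
above≤slots {m = m} {b = b} (high {x} {σ} {R} m<x p) avoids with b ≤? m
... | yes b≤m rewrite slots-≤ σ b≤m | above-∷-< R (≤-<-trans b≤m m<x) =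
      s≤s (above≤slots p λ b<c → avoids b<c ∘ Below-⊆ skip-second)
... | no  b≰m rewrite slots-≰ σ b≰m
                    | filter-reject (b <?_) {xs = R} (λ b<x → avoids b<x (m , ≰⇒> b≰m , refl ∷ (refl ∷ minimum _))) =
      above≤slots p λ b<c → avoids b<c ∘ Below-⊆ skip-second

Tight⇒¬Below : Parse m σ R π → Tight m σ R → b < c → b ∷ b ∷ [] ⊆ R → ¬ Below b (c ∷ []) (m ∷ π)
Tight⇒¬Below p t b<c bb o = <⇒≱ (slots<above b<c p o) (t _ bb)

-- A repeated b in R lies where the minimum is already below b, so one letter
-- below b precedes both copies of b as well as some c.
collect : b < c → Parse m σ R π → b ∷ b ∷ [] ⊆ R → Below b (c ∷ []) (m ∷ π) →
  ∃[ υ ] Below b υ (m ∷ π) × b ∷ b ∷ [] ⊆ υ × c ∈ υ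
collect b<c (low x≤m p) bb o
  with υ , o′ , bb′ , c∈υ ← collect b<c p bb (Below-replace x≤m (<⇒≤ b<c) o) =
  υ , Below-⊆ (_ ∷ʳ ⊆-refl) o′ , bb′ , c∈υ
collect {b} {c} {m} b<c (high m<x p) bb o with m <? b
-- The minimum `m` is the common low letter, and the whole remaining word serves as `υ`.
... | yes m<b = _ , (m , m<b , ⊆-refl) , ⊆-trans bb (refl ∷ parse-⊆ p) , to∈ (Below⇒⊆ o)
  where
  Below⇒⊆ : ∀ {π} → Below b (c ∷ []) (m ∷ π) → c ∷ [] ⊆ π
  Below⇒⊆ (_ , _ , _ ∷ s)  = s
  Below⇒⊆ (_ , _ , _ ∷ʳ s) = ⊆-trans (_ ∷ʳ ⊆-refl) s
-- Now `x` exceeds `b`, so both copies of `b` come later, and `m` is too large to be the low letter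
-- before `c`.
... | no m≮b with Below-lower m<x o | bb
...   | inj₂ (m<b , _) | _        = contradiction m<b m≮b
...   | inj₁ _         | refl ∷ _ = contradiction m<x m≮b
...   | inj₁ o′        | _ ∷ʳ bb′ with υ , o″ , bb″ , c∈υ ← collect b<c p bb′ o′ =
  υ , Below-⊆ skip-second o″ , bb″ , c∈υ

insert-⊆ : ∀ {c : A} {τ υ} → All (c ≢_) τ → τ ⊆ υ → c ∈ υ →
  ∃₂ λ τ₁ τ₂ → τ ≡ τ₁ ++ τ₂ × τ₁ ++ c ∷ τ₂ ⊆ υ
insert-⊆ _             (_ ∷ʳ s)    (here refl) = [] , _ , refl , refl ∷ s
insert-⊆ c∉            (_ ∷ʳ s)    (there c∈) with τ₁ , τ₂ , eq , s′ ← insert-⊆ c∉ s c∈ =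
  τ₁ , τ₂ , eq , _ ∷ʳ s′
insert-⊆ (c≢x ∷ _)     (refl ∷ _)  (here c≡x)  = contradiction c≡x c≢x
insert-⊆ (_ ∷ c∉)      (refl ∷ s)  (there c∈) with τ₁ , τ₂ , refl , s′ ← insert-⊆ c∉ s c∈ =
  _ ∷ τ₁ , τ₂ , refl , refl ∷ s′

-- After a letter below `b` the three orders read 1322, 1232 and 1223. Each is ruled out by 123 with
-- 1322, and equally by 132 with 1223.
merge : b < c → b ∷ b ∷ [] ⊆ υ → c ∈ υ →
  c ∷ b ∷ b ∷ [] ⊆ υ ⊎ b ∷ c ∷ b ∷ [] ⊆ υ ⊎ b ∷ b ∷ c ∷ [] ⊆ υ
merge b<c bb c∈ with insert-⊆ (>⇒≢ b<c ∷ >⇒≢ b<c ∷ []) bb c∈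
... | []             , _ , refl , s = inj₁ s
... | _ ∷ []         , _ , refl , s = inj₂ (inj₁ s)
... | _ ∷ _ ∷ []     , _ , refl , s = inj₂ (inj₂ s)

-- Avoidance as a greedy filling together with tightness.

-- A parse presupposes a first letter, so the empty word has a field of its own.
record Characterisation (P : List Pattern) : Set₁ where
  field
    Better      : ℕ → ℕ → ℕ → Set
    best        : ∀ {m x} R → m < x → ∃[ y ] m < y × y ∈ x ∷ R × All (Better m y) (x ∷ R)
    best-unique : ∀ {m x y} → m < x → m < y → Better m x y → Better m y x → x ≡ y

  open Fill Better best best-unique public

  field
    empty    : [] AvoidsAll P
    sound    : ∀ {m σ R π} → (m ∷ π) AvoidsAll P → (p : Parse m σ R π) → Greedy p × Tight m σ R
    complete : ∀ {m σ R π} {p : Parse m σ R π} → Greedy p → Tight m σ R → (m ∷ π) AvoidsAll P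

characterisation-123-1322 : Characterisation ((1 ∷ 2 ∷ 3 ∷ []) ∷ (1 ∷ 3 ∷ 2 ∷ 2 ∷ []) ∷ [])
characterisation-123-1322 = record
  { Better = Better ; best = best ; best-unique = best-unique
  ; empty = from (avoids-123 {[]}) (λ { _ (_ , _ , ()) }) ∷ from (avoids-1322 {[]}) (λ { _ (_ , _ , ()) }) ∷ []
  ; sound = λ { (n ∷ n′ ∷ []) p → greedy (to avoids-123 n) p , tight (to avoids-123 n) (to avoids-1322 n′) p }
  ; complete = λ {_} {_} {_} {_} {p} g t → from avoids-123 (no-123 g) ∷ from avoids-1322 (no-1322 p t) ∷ []
  }
  where
  open Equivalence
  Better : ℕ → ℕ → ℕ → Set
  Better m y z = z ≤ y

  best : ∀ {m x} R → m < x → ∃[ y ] m < y × y ∈ x ∷ R × All (Better m y) (x ∷ R)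
  best {x = x} R m<x =
    max x R , <-≤-trans m<x (⊥≤max x R) , attained , ⊥≤max x R ∷ xs≤max x R
    where
    attained : max x R ∈ x ∷ R
    attained with argmax-sel id x R
    ... | inj₁ e = here e
    ... | inj₂ i = there i

  best-unique : ∀ {m x y} → m < x → m < y → Better m x y → Better m y x → x ≡ y
  best-unique _ _ y≤x x≤y = ≤-antisym x≤y y≤x

  open Fill Better best best-unique

  -- A larger letter of `R` after `x` would complete a 123 with `m` and `x`.
  greedy : No123 (m ∷ π) → (p : Parse m σ R π) → Greedy p
  greedy avoids []           = []
  greedy avoids (low x≤m p)  = low (greedy (λ b<c → avoids b<c ∘ Below-⊆ (_ ∷ʳ ⊆-refl)) p)
  greedy avoids (high m<x p) = high
    (All.tabulate λ z∈R → ≮⇒≥ λ x<z → avoids x<z (_ , m<x , refl ∷ (refl ∷ from∈ (Any-resp-⊆ (parse-⊆ p) z∈R))))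
    (greedy (λ b<c → avoids b<c ∘ Below-⊆ skip-second) p)

  -- A violation would put some `c` above a repeated `b` after a letter below `b`; `collect` and
  -- `merge` turn this into a forbidden order.
  tight : No123 (m ∷ π) → No1322 (m ∷ π) → Parse m σ R π → Tight m σ R
  tight avoids avoids′ p b bb = above≤slots p λ b<c o → absurd b<c (collect b<c p bb o)
    where
    absurd : b < c → ¬ (∃[ υ ] Below b υ (_ ∷ _) × b ∷ b ∷ [] ⊆ υ × c ∈ υ)
    absurd b<c (_ , o , bb , c∈) with merge b<c bb c∈
    ... | inj₁ s        = avoids′ b<c (⊇-Below s o)
    ... | inj₂ (inj₁ s) = avoids b<c (⊇-Below (⊆-trans (refl ∷ refl ∷ (_ ∷ʳ [])) s) o)
    ... | inj₂ (inj₂ s) = avoids b<c (⊇-Below (⊆-trans (_ ∷ʳ ⊆-refl) s) o)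

  -- The last two letters of a 123 are not minima, so they would form an ascent in `R`, which a
  -- greedy filling makes weakly decreasing.
  no-123 : {p : Parse m σ R π} → Greedy p → No123 (m ∷ π)
  no-123 {p = p} g b<c o = decreasing g b<c (Below⇒⊆-high p (≤-refl ∷ <⇒≤ b<c ∷ []) o)
    where
    decreasing : {p : Parse m σ R π} → Greedy p → b < c → ¬ (b ∷ c ∷ [] ⊆ R)
    decreasing (low g)    b<c s          = decreasing g b<c s
    decreasing (high _ g) b<c (_ ∷ʳ s)   = decreasing g b<c s
    decreasing (high l g) b<c (refl ∷ s) = <⇒≱ b<c (All.lookup l (to∈ s))

  no-1322 : Parse m σ R π → Tight m σ R → No1322 (m ∷ π)
  no-1322 p t b<c o = Tight⇒¬Below p t b<c
    (⊆-trans (_ ∷ʳ ⊆-refl) (Below⇒⊆-high p (<⇒≤ b<c ∷ ≤-refl ∷ ≤-refl ∷ []) o))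
    (⊇-Below (refl ∷ minimum _) o)

characterisation-132-1223 : Characterisation ((1 ∷ 3 ∷ 2 ∷ []) ∷ (1 ∷ 2 ∷ 2 ∷ 3 ∷ []) ∷ [])
characterisation-132-1223 = record
  { Better = Better ; best = best ; best-unique = best-unique
  ; empty = from (avoids-132 {[]}) (λ { _ (_ , _ , ()) }) ∷ from (avoids-1223 {[]}) (λ { _ (_ , _ , ()) }) ∷ []
  ; sound = λ { (n ∷ n′ ∷ []) p → greedy (to avoids-132 n) p , tight (to avoids-132 n) (to avoids-1223 n′) p }
  ; complete = λ {_} {_} {_} {_} {p} g t → from avoids-132 (no-132 g) ∷ from avoids-1223 (no-1223 p t) ∷ []
  }
  where
  open Equivalence
  -- Letters not above `m` are not admissible at this position, so they do not compete.
  Better : ℕ → ℕ → ℕ → Set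
  Better m y z = m < z → y ≤ z

  best : ∀ {m x} R → m < x → ∃[ y ] m < y × y ∈ x ∷ R × All (Better m y) (x ∷ R)
  best {m} {x} R m<x =
    -- The default `x` is itself above `m`, so the minimum is attained by an admissible letter even
    -- when `R>` is empty.
    min x R> , v<min⁺ m<x (all-filter (m <?_) R) , attained
    , (λ _ → min≤⊤ x R>) ∷ All.tabulate (λ z∈R m<z → All.lookup (min≤xs x R>) (∈-filter⁺ (m <?_) z∈R m<z))
    where
    R> = filter (m <?_) R
    attained : min x R> ∈ x ∷ R
    attained with argmin-sel id x R>
    ... | inj₁ e = here e
    ... | inj₂ i = there (proj₁ (∈-filter⁻ (m <?_) {xs = R} i))

  best-unique : ∀ {m x y} → m < x → m < y → Better m x y → Better m y x → x ≡ y
  best-unique m<x m<y x≤y y≤x = ≤-antisym (x≤y m<y) (y≤x m<x)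

  open Fill Better best best-unique

  greedy : No132 (m ∷ π) → (p : Parse m σ R π) → Greedy p
  greedy avoids []           = []
  greedy avoids (low x≤m p)  = low (greedy (λ b<c → avoids b<c ∘ Below-⊆ (_ ∷ʳ ⊆-refl)) p)
  greedy avoids (high m<x p) = high
    (All.tabulate λ z∈R m<z → ≮⇒≥ λ z<x → avoids z<x (_ , m<z , refl ∷ (refl ∷ from∈ (Any-resp-⊆ (parse-⊆ p) z∈R))))
    (greedy (λ b<c → avoids b<c ∘ Below-⊆ skip-second) p)

  tight : No132 (m ∷ π) → No1223 (m ∷ π) → Parse m σ R π → Tight m σ R
  tight avoids avoids′ p b bb = above≤slots p λ b<c o → absurd b<c (collect b<c p bb o)
    where
    absurd : b < c → ¬ (∃[ υ ] Below b υ (_ ∷ _) × b ∷ b ∷ [] ⊆ υ × c ∈ υ)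
    absurd b<c (_ , o , bb , c∈) with merge b<c bb c∈
    ... | inj₁ s        = avoids b<c (⊇-Below (⊆-trans (refl ∷ refl ∷ (_ ∷ʳ [])) s) o)
    ... | inj₂ (inj₁ s) = avoids b<c (⊇-Below (⊆-trans (_ ∷ʳ ⊆-refl) s) o)
    ... | inj₂ (inj₂ s) = avoids′ b<c (⊇-Below s o)

  -- When the 3 of a 132 is placed, the later 2 is still in `R`, above the current minimum and
  -- smaller, against the greedy choice.
  no-132 : {p : Parse m σ R π} → Greedy p → No132 (m ∷ π)
  no-132 {p = []}         []         b<c (_ , _ , _ ∷ ())
  no-132 {p = []}         []         b<c (_ , _ , _ ∷ʳ ())
  no-132 {p = low x≤m p}  (low g)    b<c o = no-132 g b<c (Below-replace x≤m (<⇒≤ b<c) o)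
  no-132 {p = high m<x p} (high l g) b<c o with Below-lower m<x o
  ... | inj₁ o′                   = no-132 g b<c o′
  ... | inj₂ (m<b , _ , refl , s) =
    <⇒≱ b<c (All.lookup l (to∈ (Below⇒⊆-high p (≤-refl ∷ []) (_ , m<b , refl ∷ s))) m<b)

  no-1223 : Parse m σ R π → Tight m σ R → No1223 (m ∷ π)
  no-1223 p t b<c o = Tight⇒¬Below p t b<c
    (⊆-trans (refl ∷ refl ∷ minimum _) (Below⇒⊆-high p (≤-refl ∷ ≤-refl ∷ <⇒≤ b<c ∷ []) o))
    (⊇-Below (_ ∷ʳ (_ ∷ʳ ⊆-refl)) o)

-- The correspondence between the two classes and the count.

data Twin : Word → Word → Set where
  []  : Twin [] []
  _∷_ : ∀ m {σ R R′ π π′} → R ↭ R′ × Parse m σ R π × Parse m σ R′ π′ → Twin (m ∷ π) (m ∷ π′)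

Twin⇒↭ : Twin π π′ → π ↭ π′
Twin⇒↭ []                         = ↭-refl
Twin⇒↭ (_∷_ m {σ} (eq , p , p′)) =
  prep m (↭-trans (parse-↭ p) (↭-trans (++⁺ˡ (catMaybes σ) eq) (↭-sym (parse-↭ p′))))

IsMultipermutation-↭ : ∀ S → π ↭ π′ → IsMultipermutation S π → IsMultipermutation S π′
IsMultipermutation-↭ S eq (letters , counts) =
  All-resp-↭ eq letters , λ i → trans (sym (↭-length (filter-↭ (letter i ≟_) eq))) (counts i)

-- `refill` keeps the minima and only permutes `R`, so tightness carries over to the new word.
twin : ∀ {P Q} → Characterisation P → Characterisation Q →
  π AvoidsAll P → ∃[ π′ ] Twin π π′ × π′ AvoidsAll Q
twin {[]}    C D _  = [] , [] , Characterisation.empty D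
twin {m ∷ π} C D π-av with σ , R , p ← parse m π
  with _ , t             ← Characterisation.sound C π-av p
  with _ , _ , q , g , eq ← Characterisation.refill D σ p =
  _ , m ∷ (eq , p , q) , Characterisation.complete D g (Tight-↭ {σ = σ} eq t)

-- The common twin `w` determines the minima, and `R` up to permutation; `greedy-unique` does the
-- rest.
Twin-injective : ∀ {P} → Characterisation P → π AvoidsAll P → π′ AvoidsAll P →
  Twin π w → Twin π′ w → π ≡ π′
Twin-injective C π-av π′-π-av []                []                    = refl
Twin-injective C π-av π′-π-av (m ∷ (eq , p , q)) (.m ∷ (eq′ , p′ , q′)) with refl , refl ← parse-unique q q′ =
  cong (m ∷_) (greedy-unique (proj₁ (sound π-av p)) (proj₁ (sound π′-π-av p′)) (↭-trans eq (↭-sym eq′)))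
  where open Characterisation C

-- Remove the partner `y` of the first entry from `ys`: a later entry sharing it would equal the
-- first one, contrary to `Unique`.
length-≤-injection : ∀ {A B : Set} {_~_ : A → B → Set} {xs ys} → Unique xs →
  (∀ {x} → x ∈ xs → ∃[ y ] y ∈ ys × x ~ y) →
  (∀ {x x′ y} → x ∈ xs → x′ ∈ xs → x ~ y → x′ ~ y → x ≡ x′) →
  length xs ≤ length ys
length-≤-injection {xs = []}     _              _   _   = z≤n
length-≤-injection {_~_ = _~_} {x ∷ xs} {ys} (x∉xs ∷ uniq) tot inj
  with y , y∈ys , x~y   ← tot (here refl)
  with ys₁ , ys₂ , refl ← ∈-∃++ y∈ys
  = ≤-trans (s≤s (length-≤-injection uniq others (λ z∈ z′∈ → inj (there z∈) (there z′∈))))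
            (≤-reflexive (sym (↭-length (shift y ys₁ ys₂))))
  where
  others : ∀ {z} → z ∈ xs → ∃[ y′ ] y′ ∈ ys₁ ++ ys₂ × z ~ y′
  others z∈ with y′ , y′∈ , z~y′ ← tot (there z∈) with ∈-resp-↭ (shift y ys₁ ys₂) y′∈
  ... | here refl = contradiction (inj (here refl) (there z∈) x~y z~y′) (All.lookup x∉xs z∈)
  ... | there i   = y′ , i , z~y′

av-≤ : ∀ {P Q} → Characterisation P → Characterisation Q → ∀ S → av S P ≤ av S Q
av-≤ {P} {Q} C D S = length-≤-injection {_~_ = Twin} (avoiders-unique S P) tot
  (λ x∈ x′∈ → Twin-injective C (proj₂ (good x∈)) (proj₂ (good x′∈)))
  where
  good : π ∈ avoiders S P → GoodWord S P π
  good = Equivalence.to (∈-avoiders S P _)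
  tot : π ∈ avoiders S P → ∃[ π′ ] π′ ∈ avoiders S Q × Twin π π′
  tot π∈ with perm , π-av ← good π∈ with π′ , tw , π′-av ← twin C D π-av =
    π′ , Equivalence.from (∈-avoiders S Q π′) (IsMultipermutation-↭ S (Twin⇒↭ tw) perm , π′-av) , tw

theorem2p21 : ((1 ∷ 2 ∷ 3 ∷ []) ∷ (1 ∷ 3 ∷ 2 ∷ 2 ∷ []) ∷ [])
    ∼ ((1 ∷ 3 ∷ 2 ∷ []) ∷ (1 ∷ 2 ∷ 2 ∷ 3 ∷ []) ∷ [])
theorem2p21 S = ≤-antisym
  (av-≤ characterisation-123-1322 characterisation-132-1223 S)
  (av-≤ characterisation-132-1223 characterisation-123-1322 S)
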